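{- Let $n \geq 7$ be odd, and let $\omega_n := (1, 3, \ldots, n, n-1, n-3, \ldots, 2)$ be the cyclic order on $\{1,\ldots,n\}$ listing the odd numbers increasingly and then the even numbers decreasingly. Then $C(n,\{1,2,3\})$ is nearly dispersable with respect to $\omega_n$.
   Context: All graphs are finite and simple. For a set $S=\{i_1<\cdots<i_k\}$ of integers with $k\ge 1$, $1\le i_1$ and $i_k\le \lfloor n/2\rfloor$, the circulant $C(n,S)$ is the graph on vertex set $\{1,\ldots,n\}$ in which each $j$ is adjacent to $j+i_r$ (addition mod $n$) for $r=1,\ldots,k$. Given a graph $G$ and a cyclic order $\omega$ on $V(G)$, draw the vertices on a circle in the order $\omega$ and the edges as straight chords; two edges cross if they intersect at a point that is not an endpoint. A matching book embedding $(G,\omega,c)$ consists of $G$, a cyclic order $\omega$, and an edge-coloring $c$ (the color classes are the pages) such that any two distinct edges of the same color neither cross nor share an endpoint. The embedding is dispersable if the number of colors equals the maximum degree $\Delta(G)$, and nearly dispersable if the number of colors equals $1+\Delta(G)$. A graph is dispersable if it has a dispersable matching book embedding; it is nearly dispersable if it is not dispersable and has a nearly dispersable matching book embedding. "Nearly dispersable with respect to $\omega$" means that the graph $G$ is not dispersable and has a nearly dispersable matching book embedding $(G,\omega,c)$ with this particular cyclic order $\omega$. -}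

module Defs where

open import Data.Fin.Base as Fin using (Fin; toℕ; fromℕ<; opposite)
open import Data.Fin.Permutation using (Permutation′; permutation; _⟨$⟩ˡ_; _⟨$⟩ʳ_)
open import Data.Fin.Properties using (toℕ<n; toℕ-injective; toℕ-fromℕ<; opposite-prop; opposite-involutive)
open import Data.List.Base using (List; []; _∷_; length; filter; map; allFin)
open import Data.List.Extrema.Nat using (max)
open import Data.List.Relation.Unary.All as All using (All; []; _∷_)
open import Data.List.Relation.Unary.Any as Any using (Any)
open import Data.List.Relation.Unary.Linked using (Linked; [-]; _∷_)
open import Data.Nat.Base
open import Data.Nat.Divisibility using (_∣_; _∣?_; ∣⇒≤; divides-refl)
open import Data.Nat.DivMod using (_/_; _%_; m/n≤m; m≡m%n+[m/n]*n; m%n<n; m*n/n≡m; m*n%n≡0; [m+kn]%n≡m%n; +-distrib-/-∣ʳ)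
open import Data.Nat.Properties
open import Data.Product.Base using (Σ-syntax; _×_; _,_)
open import Data.Sum.Base as Sum using (_⊎_)
open import Function.Definitions using (Surjective)
open import Level using (0ℓ)
open import Relation.Binary.Core using (Rel)
open import Relation.Binary.Definitions using (Decidable; Symmetric; Irreflexive)
open import Relation.Binary.PropositionalEquality
open import Relation.Nullary using (¬_; yes; no; contradiction)
open import Relation.Nullary.Decidable using (_⊎-dec_)

------------------------------------------------------------------------
-- Graphs

record Graph (n : ℕ) : Set₁ where
  field
    Adj    : Rel (Fin n) 0ℓ
    adj?   : Decidable Adj
    symm   : Symmetric Adj
    irrefl : Irreflexive _≡_ Adj

-- An unordered pair of adjacent vertices, listed with the smaller one
-- first.  The proofs are irrelevant, so two edges are equal as soon as
-- their endpoints are.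
record Edge {n : ℕ} (G : Graph n) : Set where
  constructor edge
  field
    lo hi     : Fin n
    .lo<hi    : lo Fin.< hi
    .adjacent : Graph.Adj G lo hi

degree : ∀ {n} → Graph n → Fin n → ℕ
degree {n} G v = length (filter (Graph.adj? G v) (allFin n))

Δ : ∀ {n} → Graph n → ℕ
Δ {n} G = max 0 (map (degree G) (allFin n))

------------------------------------------------------------------------
-- Circulants

-- The element i of Fin n stands for the vertex 1 + i of {1, …, n}.
label : ∀ {n} → Fin n → ℕ
label i = suc (toℕ i)

infix 4 _≡_[mod_]

_≡_[mod_] : ℕ → ℕ → ℕ → Set
a ≡ b [mod n ] = n ∣ ∣ a - b ∣

-- S lists i₁ < ⋯ < i_k with k ≥ 1, 1 ≤ i₁ and i_k ≤ ⌊n/2⌋.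
record IsJumpSet (n : ℕ) (S : List ℕ) : Set where
  field
    nonempty   : S ≢ []
    increasing : Linked _<_ S
    bounds     : All (λ s → 1 ≤ s × s ≤ ⌊ n /2⌋) S

Jump : ∀ {n} → List ℕ → Rel (Fin n) 0ℓ
Jump {n} S i j = Any (λ s → label j ≡ label i + s [mod n ]) S

jump? : ∀ {n} (S : List ℕ) → Decidable (Jump {n} S)
jump? {n} S i j = Any.any? (λ s → n ∣? ∣ label j - (label i + s) ∣) S

jump-irrefl : ∀ {n} {S : List ℕ} → IsJumpSet n S → (i : Fin n) → ¬ Jump S i i
jump-irrefl {n} J i p = go (IsJumpSet.bounds J) p
  where
  go : ∀ {S} → All (λ s → 1 ≤ s × s ≤ ⌊ n /2⌋) S → ¬ Jump S i i
  go (_ ∷ bs) (Any.there q) = go bs q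
  go {suc s ∷ _} ((_ , s≤) ∷ _) (Any.here d) =
    <⇒≱ (<-≤-trans (half< (toℕ<n i)) n≤s) s≤
    where
    n≤s : n ≤ suc s
    n≤s = ∣⇒≤ (subst (n ∣_) (∣m-m+n∣≡n (label i) (suc s)) d)
    half< : ∀ {k m} → k < m → ⌊ m /2⌋ < m
    half< {m = suc m} _ = ⌊n/2⌋<n m

C : (n : ℕ) (S : List ℕ) → IsJumpSet n S → Graph n
C n S J = record
  { Adj    = λ i j → Jump S i j ⊎ Jump S j i
  ; adj?   = λ i j → jump? S i j ⊎-dec jump? S j i
  ; symm   = Sum.swap
  ; irrefl = λ { {i} refl → Sum.[ jump-irrefl J i , jump-irrefl J i ] }
  }

jumps-1-2-3 : ∀ {n} → 7 ≤ n → IsJumpSet n (1 ∷ 2 ∷ 3 ∷ [])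
jumps-1-2-3 {n} 7≤n = record
  { nonempty   = λ ()
  ; increasing = ≤-refl ∷ ≤-refl ∷ [-]
  ; bounds     = (s≤s z≤n , ≤-trans (s≤s z≤n) 3≤) ∷ (s≤s z≤n , ≤-trans (s≤s (s≤s z≤n)) 3≤)
               ∷ (s≤s z≤n , 3≤) ∷ []
  }
  where
  3≤ : 3 ≤ ⌊ n /2⌋
  3≤ = ⌊n/2⌋-mono 7≤n

------------------------------------------------------------------------
-- Matching book embeddings

-- A cyclic order, cut open at some point: ω ⟨$⟩ʳ p is the vertex in
-- position p and ω ⟨$⟩ˡ v is the position of v.  Crossings do not depend
-- on where the circle is cut.
CyclicOrder : ℕ → Set
CyclicOrder = Permutation′

module _ {n : ℕ} {G : Graph n} where

  open Edge

  left right : CyclicOrder n → Edge G → ℕ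
  left  ω e = toℕ (ω ⟨$⟩ˡ lo e) ⊓ toℕ (ω ⟨$⟩ˡ hi e)
  right ω e = toℕ (ω ⟨$⟩ˡ lo e) ⊔ toℕ (ω ⟨$⟩ˡ hi e)

  -- Two distinct chords of a circle meet in a point other than an endpoint
  -- exactly when their endpoints alternate strictly around the circle.
  Cross : CyclicOrder n → Edge G → Edge G → Set
  Cross ω e f =
      (left ω e < left ω f × left ω f < right ω e × right ω e < right ω f)
    ⊎ (left ω f < left ω e × left ω e < right ω f × right ω f < right ω e)

  ShareEndpoint : Edge G → Edge G → Set
  ShareEndpoint e f = (lo e ≡ lo f ⊎ lo e ≡ hi f) ⊎ (hi e ≡ lo f ⊎ hi e ≡ hi f)

-- Surjectivity makes k the number of colors that actually occur.
record MatchingBookEmbedding {n : ℕ} (G : Graph n) (ω : CyclicOrder n) (k : ℕ) : Set where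
  field
    color      : Edge G → Fin k
    surjective : Surjective _≡_ _≡_ color
    noCrossing : ∀ e f → e ≢ f → color e ≡ color f → ¬ Cross ω e f
    matching   : ∀ e f → e ≢ f → color e ≡ color f → ¬ ShareEndpoint e f

Dispersable : ∀ {n} → Graph n → Set
Dispersable {n} G = Σ[ ω ∈ CyclicOrder n ] MatchingBookEmbedding G ω (Δ G)

NearlyDispersableWrt : ∀ {n} → Graph n → CyclicOrder n → Set
NearlyDispersableWrt G ω = ¬ Dispersable G × MatchingBookEmbedding G ω (1 + Δ G)

------------------------------------------------------------------------
-- The cyclic order (1, 3, 5, …, 6, 4, 2)

double : ∀ k → k * 2 ≡ k + k
double k = trans (*-comm k 2) (cong (k +_) (+-identityʳ k))

opposite-sum : ∀ {n} (p : Fin n) → toℕ (opposite p) + suc (toℕ p) ≡ n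
opposite-sum p = trans (cong (_+ suc (toℕ p)) (opposite-prop p)) (m∸n+n≡m (toℕ<n p))

-- Applied to m = n - 1 - k.
late-fits : ∀ {n} m k → m + suc k ≡ n → ¬ (k * 2 < n) → suc (m * 2) < n
late-fits {n} m k refl 2k≮n = begin-strict
  suc (m * 2)  ≡⟨ cong suc (double m) ⟩
  suc m + m    ≤⟨ +-monoˡ-≤ m m<k ⟩
  k + m        ≡⟨ +-comm k m ⟩
  m + k        <⟨ +-monoʳ-< m (n<1+n k) ⟩
  m + suc k    ∎
  where
  open ≤-Reasoning
  m<k : m < k
  m<k = +-cancelʳ-≤ k (suc m) k
    (subst₂ _≤_ (+-suc m k) (double k) (≮⇒≥ 2k≮n))

late-is-late : ∀ {n} m k → m + suc k ≡ n → suc (m * 2) < n → ¬ (k * 2 < n)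
late-is-late m k refl 1+2m<n = ≤⇒≯ (begin
  m + suc k  ≡⟨ +-suc m k ⟩
  suc m + k  ≤⟨ +-monoˡ-≤ k m<k ⟩
  k + k      ≡⟨ double k ⟨
  k * 2      ∎)
  where
  open ≤-Reasoning
  m<k : m < k
  m<k = s<s⁻¹ (+-cancelˡ-< m (suc m) (suc k)
    (subst (_< m + suc k) (trans (cong suc (double m)) (sym (+-suc m m))) 1+2m<n))

-- Position p (counted from 0) holds the vertex labelled 2p + 1 as long as
-- this is at most n, and the vertex labelled 2(n - p) afterwards.  In Fin n
-- these are 2p and 2(n - 1 - p) + 1, and opposite p is n - 1 - p.
vertexAt : ∀ {n} → Fin n → Fin n
vertexAt {n} p with toℕ p * 2 <? n
... | yes 2p<n = fromℕ< 2p<n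
... | no  2p≮n = fromℕ< (late-fits (toℕ (opposite p)) (toℕ p) (opposite-sum p) 2p≮n)

half : ∀ {n} → Fin n → Fin n
half v = fromℕ< (≤-<-trans (m/n≤m (toℕ v) 2) (toℕ<n v))

positionOf : ∀ {n} → Fin n → Fin n
positionOf v with toℕ v % 2
... | zero  = half v
... | suc _ = opposite (half v)

vertexAt-early : ∀ {n} (p : Fin n) → toℕ p * 2 < n → toℕ (vertexAt p) ≡ toℕ p * 2
vertexAt-early {n} p 2p<n with toℕ p * 2 <? n
... | yes q    = toℕ-fromℕ< q
... | no  2p≮n = contradiction 2p<n 2p≮n

vertexAt-late : ∀ {n} (p : Fin n) → ¬ (toℕ p * 2 < n) →
                toℕ (vertexAt p) ≡ suc (toℕ (opposite p) * 2)
vertexAt-late {n} p 2p≮n with toℕ p * 2 <? n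
... | yes 2p<n = contradiction 2p<n 2p≮n
... | no  q    = toℕ-fromℕ< (late-fits (toℕ (opposite p)) (toℕ p) (opposite-sum p) q)

toℕ-half : ∀ {n} (v : Fin n) → toℕ (half v) ≡ toℕ v / 2
toℕ-half v = toℕ-fromℕ< (≤-<-trans (m/n≤m (toℕ v) 2) (toℕ<n v))

positionOf-even : ∀ {n} (v h : Fin n) → toℕ v ≡ toℕ h * 2 → positionOf v ≡ h
positionOf-even v h eq with toℕ v % 2 in r
... | zero  = toℕ-injective
  (trans (toℕ-half v) (trans (cong (_/ 2) eq) (m*n/n≡m (toℕ h) 2)))
... | suc _ = contradiction
  (trans (sym r) (trans (cong (_% 2) eq) (m*n%n≡0 (toℕ h) 2))) λ ()

positionOf-odd : ∀ {n} (v h : Fin n) → toℕ v ≡ suc (toℕ h * 2) → positionOf v ≡ opposite h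
positionOf-odd v h eq with toℕ v % 2 in r
... | zero  = contradiction
  (trans (sym r) (trans (cong (_% 2) eq) ([m+kn]%n≡m%n 1 (toℕ h) 2))) λ ()
... | suc _ = cong opposite (toℕ-injective
  (trans (toℕ-half v) (trans (cong (_/ 2) eq)
    (trans (+-distrib-/-∣ʳ 1 {toℕ h * 2} {2} (divides-refl (toℕ h))) (m*n/n≡m (toℕ h) 2)))))

vertexAt-positionOf : ∀ {n} (v : Fin n) → vertexAt (positionOf v) ≡ v
vertexAt-positionOf {n} v with toℕ v % 2 in r | m≡m%n+[m/n]*n (toℕ v) 2 | m%n<n (toℕ v) 2
... | 0 | eq | _ = toℕ-injective (trans (vertexAt-early h (subst (_< n) eq′ (toℕ<n v))) (sym eq′))
  where
  h = half v
  eq′ : toℕ v ≡ toℕ h * 2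
  eq′ = trans eq (cong (_* 2) (sym (toℕ-half v)))
... | 1 | eq | _ = toℕ-injective (begin
  toℕ (vertexAt (opposite h))           ≡⟨ vertexAt-late (opposite h) late ⟩
  suc (toℕ (opposite (opposite h)) * 2) ≡⟨ cong (λ x → suc (toℕ x * 2)) (opposite-involutive h) ⟩
  suc (toℕ h * 2)                       ≡⟨ eq′ ⟨
  toℕ v                                 ∎)
  where
  open ≡-Reasoning
  h = half v
  eq′ : toℕ v ≡ suc (toℕ h * 2)
  eq′ = trans eq (cong (λ x → suc (x * 2)) (sym (toℕ-half v)))
  late : ¬ (toℕ (opposite h) * 2 < n)
  late = late-is-late (toℕ h) (toℕ (opposite h))
    (trans (+-suc (toℕ h) _) (trans (+-comm (suc (toℕ h)) _) (opposite-sum h)))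
    (subst (_< n) eq′ (toℕ<n v))
... | suc (suc _) | _ | s≤s (s≤s ())

positionOf-vertexAt : ∀ {n} (p : Fin n) → positionOf (vertexAt p) ≡ p
positionOf-vertexAt {n} p with toℕ p * 2 <? n
... | yes q = positionOf-even _ p (toℕ-fromℕ< q)
... | no  q = trans
  (positionOf-odd _ (opposite p)
    (toℕ-fromℕ< (late-fits (toℕ (opposite p)) (toℕ p) (opposite-sum p) q)))
  (opposite-involutive p)

ω : (n : ℕ) → CyclicOrder n
ω n = permutation vertexAt positionOf vertexAt-positionOf positionOf-vertexAt

_ : map (λ p → label (ω 9 ⟨$⟩ʳ p)) (allFin 9) ≡ 1 ∷ 3 ∷ 5 ∷ 7 ∷ 9 ∷ 8 ∷ 6 ∷ 4 ∷ 2 ∷ []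
_ = refl

{-# OPTIONS --safe #-}
-- C(n,{1,2,3}) is 6-regular.  In a matching coloring with six colors every vertex would see every
-- color, so each color class would be a perfect matching, impossible for odd n; for the same reason
-- a matching coloring with seven colors uses all of them.  Chords of a circle of n positions with
-- congruent position sums modulo n are parallel, and a chord between consecutive positions crosses
-- nothing.  Seven pages consisting of such chords suffice: two for the jumps by 1, two for the jumps
-- by 3, and three for the six edges that wrap around n; the jumps by 2 join consecutive positions
-- and are fitted into the gaps.
module Submission where

open import Algebra.Properties.CommutativeMonoid.Sum using (sum; ∑-distrib-+; sum-permute)
open import Algebra.Properties.Monoid.Sum using (sum-cong-≗)
open import Data.Bool.Base using (Bool; true; false; not)
open import Data.Empty using (⊥)
open import Data.Fin.Base as Fin using (Fin; toℕ; fromℕ<; opposite; splitAt; join; punchIn; punchOut)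
open import Data.Fin.Patterns
open import Data.Fin.Permutation using (Permutation′; permutation)
open import Data.Fin.Properties as Fin using (any?; injective⇒≤; join-splitAt; punchInᵢ≢i; punchOut-injective; toℕ<n; toℕ-fromℕ<; toℕ-injective)
open import Data.List using ([]; _∷_; length; filter; map; allFin)
open import Data.List.Extrema using (max≈v⁺)
open import Data.List.Membership.Propositional using (_∈_)
open import Data.List.Membership.Propositional.Properties using (∈-allFin; ∈-filter⁺; ∈-filter⁻; ∈-map⁺; ∈-map⁻)
open import Data.List.Membership.Propositional.Properties.WithK using (unique∧set⇒bag)
open import Data.List.Properties using (length-map; length-tabulate)
open import Data.List.Relation.Binary.BagAndSetEquality using (∼bag⇒↭)
open import Data.List.Relation.Binary.Permutation.Propositional.Properties using (↭-length)
import Data.List.Relation.Unary.All as All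
import Data.List.Relation.Unary.All.Properties as All
open import Data.List.Relation.Unary.Any using (here; there)
import Data.List.Relation.Unary.Unique.Propositional.Properties as Unique
open import Data.Nat
open import Data.Nat.Divisibility using (_∣_; divides; _∣0; ∣-refl)
open import Data.Nat.DivMod using (m≡m%n+[m/n]*n; m*n%n≡0; [m+kn]%n≡m%n)
open import Data.Nat.Properties
open import Data.Nat.Tactic.RingSolver using (solve-∀)
open import Data.Product.Base using (∃; _×_; _,_; proj₁; proj₂)
open import Data.Sum.Base as Sum using (_⊎_; inj₁; inj₂)
open import Data.Unit.Base using (⊤; tt)
open import Function.Base using (_∘_; id)
open import Function.Bundles using (mk⇔)
open import Function.Definitions using (Injective)
open import Relation.Binary.Definitions using (DecidableEquality; tri<; tri≈; tri>)
open import Relation.Binary.PropositionalEquality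
open import Relation.Nullary using (¬_; yes; no; contradiction)
open import Relation.Nullary.Decidable using (map′; recompute; _×-dec_)
open import Defs

open Edge using (lo; hi)

-- Pigeonhole and parity on finite sets.

injective⇒surjective : ∀ {n} {f : Fin n → Fin n} → Injective _≡_ _≡_ f → ∀ y → ∃ λ x → f x ≡ y
injective⇒surjective {suc n} {f} inj y with any? (λ x → f x Fin.≟ y)
... | yes hit  = hit
... | no  miss = contradiction
  (injective⇒≤ (λ {i} {j} → inj ∘ punchOut-injective (y≢ i) (y≢ j)))
  (<⇒≱ (n<1+n n))
  where
  y≢ : ∀ x → y ≢ f x
  y≢ x eq = miss (x , sym eq)

sum-ones : ∀ n → sum +-0-commutativeMonoid {n} (λ _ → 1) ≡ n
sum-ones zero    = refl
sum-ones (suc n) = cong suc (sum-ones n)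

-- The points moved upwards are exchanged with the points moved downwards.
fixpoint-free-involution⇒even : ∀ {n} (f : Fin n → Fin n) → (∀ v → f (f v) ≡ v) → (∀ v → f v ≢ v) →
                                ∃ λ h → n ≡ h + h
fixpoint-free-involution⇒even {n} f f∘f f≢ = ∑ up , (begin
  n                                ≡⟨ sum-ones n ⟨
  ∑ (λ _ → 1)                      ≡⟨ sum-cong-≗ +-0-monoid exactly-one ⟨
  ∑ (λ v → up v + up (f v))        ≡⟨ ∑-distrib-+ +-0-commutativeMonoid up (up ∘ f) ⟩
  ∑ up + ∑ (up ∘ f)                ≡⟨ cong (∑ up +_) (sum-permute +-0-commutativeMonoid up π) ⟨
  ∑ up + ∑ up                      ∎)
  where
  open ≡-Reasoning
  ∑ : (Fin n → ℕ) → ℕ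
  ∑ = sum +-0-commutativeMonoid
  π : Permutation′ n
  π = permutation f f f∘f f∘f
  up : Fin n → ℕ
  up v with Fin.<-cmp v (f v)
  ... | tri< _ _ _ = 1
  ... | tri≈ _ _ _ = 0
  ... | tri> _ _ _ = 0
  exactly-one : ∀ v → up v + up (f v) ≡ 1
  exactly-one v with Fin.<-cmp v (f v) | Fin.<-cmp (f v) (f (f v))
  ... | tri< v<fv _ _ | tri< fv<ffv _ _ = contradiction (subst (f v Fin.<_) (f∘f v) fv<ffv) (<-asym v<fv)
  ... | tri< _ _ _    | tri≈ _ _ _      = refl
  ... | tri< _ _ _    | tri> _ _ _      = refl
  ... | tri≈ _ eq _   | _               = contradiction (sym eq) (f≢ v)
  ... | tri> _ _ _    | tri< _ _ _      = refl
  ... | tri> _ _ _    | tri≈ _ eq _     = contradiction (sym eq) (f≢ (f v))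
  ... | tri> _ _ fv<v | tri> _ _ ffv<fv = contradiction (subst (Fin._< f v) (f∘f v) ffv<fv) (<-asym fv<v)

-- Edges as unordered pairs, and matchings.

module _ {n : ℕ} {G : Graph n} where

  edge-≡ : ∀ {e f : Edge G} → lo e ≡ lo f → hi e ≡ hi f → e ≡ f
  edge-≡ refl refl = refl

  _≟ᵉ_ : DecidableEquality (Edge G)
  e ≟ᵉ f = map′ (λ (p , q) → edge-≡ p q) (λ { refl → refl , refl })
    ((lo e Fin.≟ lo f) ×-dec (hi e Fin.≟ hi f))

  -- The stored inequality is irrelevant, so it is recovered from the decidability of `<`.
  lo<hi : (e : Edge G) → lo e Fin.< hi e
  lo<hi (edge _ _ p _) = recompute (_ <? _) p

  -- Forgets which endpoint is stored first, so that an edge can be followed from either end.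
  Joins : Edge G → Fin n → Fin n → Set
  Joins e v w = (lo e ≡ v × hi e ≡ w) ⊎ (lo e ≡ w × hi e ≡ v)

  joins-sym : ∀ e {v w} → Joins e v w → Joins e w v
  joins-sym _ = Sum.swap

  joining : ∀ {v w} → Graph.Adj G v w → ∃ λ e → Joins e v w
  joining {v} {w} adj with Fin.<-cmp v w
  ... | tri< v<w _ _ = edge v w v<w adj , inj₁ (refl , refl)
  ... | tri≈ _ v≡w _ = contradiction adj (Graph.irrefl G v≡w)
  ... | tri> _ _ w<v = edge w v w<v (Graph.symm G adj) , inj₂ (refl , refl)

  joins-functional : ∀ e {v w x} → Joins e v w → Joins e v x → w ≡ x
  joins-functional _ (inj₁ (_ , refl))    (inj₁ (_ , refl))    = refl
  joins-functional _ (inj₁ (refl , refl)) (inj₂ (refl , refl)) = refl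
  joins-functional _ (inj₂ (refl , refl)) (inj₁ (refl , refl)) = refl
  joins-functional _ (inj₂ (refl , _))    (inj₂ (refl , _))    = refl

  joins-share : ∀ e f {v w x} → Joins e v w → Joins f v x → ShareEndpoint e f
  joins-share _ _ (inj₁ (refl , _)) (inj₁ (p , _)) = inj₁ (inj₁ (sym p))
  joins-share _ _ (inj₁ (refl , _)) (inj₂ (_ , p)) = inj₁ (inj₂ (sym p))
  joins-share _ _ (inj₂ (_ , refl)) (inj₁ (p , _)) = inj₂ (inj₁ (sym p))
  joins-share _ _ (inj₂ (_ , refl)) (inj₂ (_ , p)) = inj₂ (inj₂ (sym p))

  IsMatching : {A : Set} → (Edge G → A) → Set
  IsMatching col = ∀ e f → e ≢ f → col e ≡ col f → ¬ ShareEndpoint e f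

  -- Two edges of one color that meet in `v` must coincide. This turns a color class into a partial
  -- function sending a vertex to its partner.
  matched-functional : ∀ {A} {col : Edge G → A} → IsMatching col →
                       ∀ e f {v w x} → Joins e v w → Joins f v x → col e ≡ col f → w ≡ x
  matched-functional M e f e-vw f-vx same with e ≟ᵉ f
  ... | yes refl = joins-functional e e-vw f-vx
  ... | no  e≢f  = contradiction (joins-share e f e-vw f-vx) (M e f e≢f same)

-- Regular graphs of odd order.

-- The neighbours come numbered, so that the colors seen at a vertex form a map out of `Fin k`, to
-- which pigeonhole applies.
record Regular {n : ℕ} (G : Graph n) (k : ℕ) : Set where
  field
    neighbour           : Fin n → Fin k → Fin n
    neighbour-injective : ∀ v → Injective _≡_ _≡_ (neighbour v)
    neighbour-adjacent  : ∀ v i → Graph.Adj G v (neighbour v i)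
    neighbour-complete  : ∀ {v w} → Graph.Adj G v w → ∃ λ i → w ≡ neighbour v i

module _ {n k : ℕ} {G : Graph n} (R : Regular G k) where

  open Regular R
  open Graph G

  -- Both lists are free of repetitions and have the same members, hence are permutations of each
  -- other.
  degree-regular : ∀ v → degree G v ≡ k
  degree-regular v = begin
    length (filter (adj? v) (allFin n))       ≡⟨ ↭-length (∼bag⇒↭ (unique∧set⇒bag
                                                   (Unique.filter⁺ (adj? v) (Unique.allFin⁺ n))
                                                   (Unique.map⁺ (neighbour-injective v) (Unique.allFin⁺ k))
                                                   (mk⇔ to from))) ⟩
    length (map (neighbour v) (allFin k))     ≡⟨ length-map (neighbour v) (allFin k) ⟩
    length (allFin k)                         ≡⟨ length-tabulate id ⟩
    k                                         ∎
    where
    open ≡-Reasoning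
    to : ∀ {w} → w ∈ filter (adj? v) (allFin n) → w ∈ map (neighbour v) (allFin k)
    to w∈ with i , refl ← neighbour-complete (proj₂ (∈-filter⁻ (adj? v) {xs = allFin n} w∈)) =
      ∈-map⁺ (neighbour v) (∈-allFin i)
    from : ∀ {w} → w ∈ map (neighbour v) (allFin k) → w ∈ filter (adj? v) (allFin n)
    from w∈ with i , _ , refl ← ∈-map⁻ (neighbour v) w∈ =
      ∈-filter⁺ (adj? v) (∈-allFin _) (neighbour-adjacent v i)

  Δ-regular : Fin n → Δ G ≡ k
  Δ-regular v = max≈v⁺ ≤-totalOrder
    (subst (_∈ map (degree G) (allFin n)) (degree-regular v) (∈-map⁺ (degree G) (∈-allFin v)))
    (All.map⁺ (All.universal (≤-reflexive ∘ degree-regular) (allFin n)))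
    z≤n

  dart : Fin n → Fin k → Edge G
  dart v i = proj₁ (joining (neighbour-adjacent v i))

  dart-joins : ∀ v i → Joins (dart v i) v (neighbour v i)
  dart-joins v i = proj₂ (joining (neighbour-adjacent v i))

  module _ {A : Set} {col : Edge G → A} (M : IsMatching col) where

    colors-at-injective : ∀ v → Injective _≡_ _≡_ (λ i → col (dart v i))
    colors-at-injective v same =
      neighbour-injective v (matched-functional M _ _ (dart-joins v _) (dart-joins v _) same)

    -- Sending each vertex to its partner along color `c` is an involution without fixed points.
    perfect-color⇒even : ∀ c → (∀ v → ∃ λ i → col (dart v i) ≡ c) → ∃ λ h → n ≡ h + h
    perfect-color⇒even c seen = fixpoint-free-involution⇒even mate involutive free
      where
      mate : Fin n → Fin n
      mate v = neighbour v (proj₁ (seen v))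
      joined : ∀ v → Joins (dart v (proj₁ (seen v))) v (mate v)
      joined v = dart-joins v (proj₁ (seen v))
      involutive : ∀ v → mate (mate v) ≡ v
      -- The `c`-colored edges chosen at `v` and at `mate v` both meet `mate v`, so their other ends
      -- agree.
      involutive v = matched-functional M _ (dart v (proj₁ (seen v))) (joined (mate v)) (joins-sym (dart v _) (joined v))
        (trans (proj₂ (seen (mate v))) (sym (proj₂ (seen v))))
      free : ∀ v → mate v ≢ v
      free v eq = irrefl (sym eq) (neighbour-adjacent v (proj₁ (seen v)))

  -- The `k` edges at a vertex have distinct colors, so with `k` colors in all every vertex sees
  -- each of them.
  matching-degree-colors⇒even : {col : Edge G → Fin k} → IsMatching col → Fin k → ∃ λ h → n ≡ h + h
  matching-degree-colors⇒even M c =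
    perfect-color⇒even M c (λ v → injective⇒surjective (colors-at-injective M v) c)

-- If c were missing, each vertex would see all the other colors.
all-colors-occur : ∀ {n k} {G : Graph n} → Regular G (suc k) →
                   {col : Edge G → Fin (2 + k)} → IsMatching col → (∀ h → n ≢ h + h) →
                   ∀ c → ∃ λ e → col e ≡ c
all-colors-occur {n} {k} R {col} M odd c
  with any? (λ v → any? (λ i → col (dart R v i) Fin.≟ c))
... | yes (v , i , eq) = dart R v i , eq
... | no miss = contradiction (proj₂ even) (odd (proj₁ even))
  where
  -- Any color other than `c` would do; its class would be a perfect matching.
  d = punchIn c Fin.zero
  c≢d : c ≢ d
  c≢d eq = punchInᵢ≢i c Fin.zero (sym eq)
  c≢ : ∀ v i → c ≢ col (dart R v i)
  c≢ v i eq = miss (v , i , sym eq)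
  seen : ∀ v → ∃ λ i → col (dart R v i) ≡ d
  seen v with i , eq ← injective⇒surjective {f = λ i → punchOut (c≢ v i)}
      (λ {i} {j} → colors-at-injective R M v ∘ punchOut-injective (c≢ v i) (c≢ v j)) (punchOut c≢d) =
    i , punchOut-injective (c≢ v i) c≢d eq
  even = perfect-color⇒even R M d seen

-- The vertex argument makes the maximum defining `Δ` range over a nonempty set, so that it equals
-- the common degree.
regular-odd-nearly-dispersable : ∀ {n k} {G : Graph n} {ω : CyclicOrder n} →
  Regular G (suc k) → Fin n → (∀ h → n ≢ h + h) → (col : Edge G → Fin (2 + k)) → IsMatching col →
  (∀ e f → e ≢ f → col e ≡ col f → ¬ Cross ω e f) → NearlyDispersableWrt G ω
regular-odd-nearly-dispersable {n} {k} {G} {ω} R v odd col M noncrossing = not-dispersable ,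
  subst (λ d → MatchingBookEmbedding G ω (suc d)) (sym Δ≡) (record
    { color      = col
    ; surjective = λ c → let e , eq = all-colors-occur R M odd c in e , λ { refl → eq }
    ; noCrossing = noncrossing
    ; matching   = M
    })
  where
  Δ≡ : Δ G ≡ suc k
  Δ≡ = Δ-regular R v
  not-dispersable : ¬ Dispersable G
  not-dispersable (ω′ , E) =
    let h , even = matching-degree-colors⇒even R
          (MatchingBookEmbedding.matching (subst (MatchingBookEmbedding G ω′) Δ≡ E)) 0F
    in odd h even

-- Addition modulo n on representatives.

-- Representatives below `n` and shifts of at most `n` wrap around at most once, so two linear
-- equations replace `%`.
Step : ℕ → ℕ → ℕ → ℕ → Set
Step n a v w = w ≡ v + a ⊎ w + n ≡ v + a

module _ {n : ℕ} where

  step-functional : ∀ {a v w x} → w < n → x < n → Step n a v w → Step n a v x → w ≡ x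
  step-functional _   _   (inj₁ p) (inj₁ q) = trans p (sym q)
  step-functional w<n _   (inj₁ p) (inj₂ q) =
    contradiction (≤-trans (m≤n+m n _) (≤-reflexive (trans q (sym p)))) (<⇒≱ w<n)
  step-functional _   x<n (inj₂ p) (inj₁ q) =
    contradiction (≤-trans (m≤n+m n _) (≤-reflexive (trans p (sym q)))) (<⇒≱ x<n)
  step-functional _   _   (inj₂ p) (inj₂ q) = +-cancelʳ-≡ n _ _ (trans p (sym q))

  step-injective : ∀ {a b v w} → a < n → b < n → Step n a v w → Step n b v w → a ≡ b
  step-injective {a} {b} {v} a<n b<n (inj₁ p) (inj₁ q) = +-cancelˡ-≡ v _ _ (trans (sym p) q)
  step-injective {a} {b} {v} a<n b<n (inj₂ p) (inj₂ q) = +-cancelˡ-≡ v _ _ (trans (sym p) q)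
  step-injective {a} {b} {v} a<n b<n (inj₁ p) (inj₂ q) = contradiction
    (≤-trans (m≤n+m n a) (≤-reflexive (+-cancelˡ-≡ v _ _
      (trans (sym (+-assoc v a n)) (trans (cong (_+ n) (sym p)) q)))))
    (<⇒≱ b<n)
  step-injective {a} {b} {v} a<n b<n (inj₂ p) (inj₁ q) = contradiction
    (≤-trans (m≤n+m n b) (≤-reflexive (+-cancelˡ-≡ v _ _
      (trans (sym (+-assoc v b n)) (trans (cong (_+ n) (sym q)) p)))))
    (<⇒≱ a<n)

  -- Going back by `a` is going forward by its complement, so both directions of a jump become
  -- shifts.
  step-reverse : ∀ {a b v w} → a + b ≡ n → Step n a w v → Step n b v w
  step-reverse {a} {b} {v} {w} refl (inj₁ refl) = inj₂ (sym (+-assoc w a b))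
  step-reverse {a} {b} {v} {w} refl (inj₂ p)    = inj₁ (+-cancelʳ-≡ a _ _ (begin
    w + a        ≡⟨ p ⟨
    v + (a + b)  ≡⟨ cong (v +_) (+-comm a b) ⟩
    v + (b + a)  ≡⟨ +-assoc v b a ⟨
    v + b + a    ∎))
    where open ≡-Reasoning

  step : ∀ {a} → a ≤ n → (v : Fin n) → ∃ λ w → Step n a (toℕ v) (toℕ {n} w)
  step {a} a≤n v with toℕ v + a <? n
  ... | yes v+a<n = fromℕ< v+a<n , inj₁ (toℕ-fromℕ< v+a<n)
  ... | no  v+a≮n = fromℕ< fits , inj₂ (trans (cong (_+ n) (toℕ-fromℕ< fits)) (m∸n+n≡m (≮⇒≥ v+a≮n)))
    where
    fits : toℕ v + a ∸ n < n
    fits = +-cancelʳ-< n _ _ (subst (_< n + n) (sym (m∸n+n≡m (≮⇒≥ v+a≮n)))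
      (+-mono-<-≤ (toℕ<n v) a≤n))

  small-multiple : ∀ {d} → n ∣ d → d < n + n → d ≡ 0 ⊎ d ≡ n
  small-multiple (divides 0 refl) _ = inj₁ refl
  small-multiple (divides 1 refl) _ = inj₂ (+-identityʳ n)
  small-multiple (divides (suc (suc k)) refl) d<2n =
    contradiction (+-monoʳ-≤ n (m≤m+n n (k * n))) (<⇒≱ d<2n)

  toℕ∸< : (w : Fin n) (b : ℕ) → toℕ w ∸ b < n
  toℕ∸< w b = ≤-<-trans (m∸n≤m (toℕ w) b) (toℕ<n w)

  -- The difference is a multiple of `n` below `2n`, hence 0 or `n`. When `w` is the larger side it
  -- is even below `n`, which leaves only 0.
  congruent⇒step : ∀ {a} → a ≤ n → (v w : Fin n) → label w ≡ label v + a [mod n ] →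
                   Step n a (toℕ v) (toℕ w)
  congruent⇒step {a} a≤n v w n∣ with ≤-total (toℕ w) (toℕ v + a)
  ... | inj₁ w≤ with small-multiple (subst (n ∣_) (m≤n⇒∣m-n∣≡n∸m w≤) n∣)
                       (≤-<-trans (m∸n≤m _ (toℕ w)) (+-mono-<-≤ (toℕ<n v) a≤n))
  ...   | inj₁ eq = inj₁ (≤-antisym w≤ (m∸n≡0⇒m≤n eq))
  ...   | inj₂ eq = inj₂ (trans (cong (toℕ w +_) (sym eq)) (m+[n∸m]≡n w≤))
  congruent⇒step {a} a≤n v w n∣ | inj₂ w≥
    with small-multiple (subst (n ∣_) (m≤n⇒∣n-m∣≡n∸m w≥) n∣)
           (<-≤-trans (toℕ∸< w (toℕ v + a)) (m≤m+n n n))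
  ...   | inj₁ eq = inj₁ (≤-antisym (m∸n≡0⇒m≤n {toℕ w} eq) w≥)
  ...   | inj₂ eq = contradiction eq (<⇒≢ (toℕ∸< w (toℕ v + a)))

  step⇒congruent : ∀ {a} (v w : Fin n) → Step n a (toℕ v) (toℕ w) → label w ≡ label v + a [mod n ]
  step⇒congruent {a} v w (inj₁ eq) = subst (n ∣_) (sym (m≡n⇒∣m-n∣≡0 eq)) (n ∣0)
  step⇒congruent {a} v w (inj₂ eq) =
    subst (λ x → n ∣ ∣ toℕ w - x ∣) eq (subst (n ∣_) (sym (∣m-m+n∣≡n (toℕ w) n)) ∣-refl)

-- The circulant is 6-regular.

module _ (q : ℕ) (7≤n : 7 ≤ 7 + q) where

  private
    n = 7 + q
    G = C n (1 ∷ 2 ∷ 3 ∷ []) (jumps-1-2-3 7≤n)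

  -- The second block is `n - 3`, `n - 2`, `n - 1`, the backward jumps; it starts above 3 because
  -- `n ≥ 7`.
  signed-shift : Fin 3 ⊎ Fin 3 → ℕ
  signed-shift (inj₁ i) = 1 + toℕ i
  signed-shift (inj₂ i) = toℕ i + (4 + q)

  signed-shift-injective : Injective _≡_ _≡_ signed-shift
  signed-shift-injective {inj₁ i} {inj₁ j} eq = cong inj₁ (toℕ-injective (suc-injective eq))
  signed-shift-injective {inj₂ i} {inj₂ j} eq = cong inj₂ (toℕ-injective (+-cancelʳ-≡ (4 + q) _ _ eq))
  signed-shift-injective {inj₁ i} {inj₂ j} eq =
    contradiction (subst (_≤ 3) eq (toℕ<n i)) (<⇒≱ (≤-trans (m≤m+n 4 q) (m≤n+m (4 + q) (toℕ j))))
  signed-shift-injective {inj₂ i} {inj₁ j} eq =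
    contradiction (subst (_≤ 3) (sym eq) (toℕ<n j)) (<⇒≱ (≤-trans (m≤m+n 4 q) (m≤n+m (4 + q) (toℕ i))))

  shift : Fin 6 → ℕ
  shift = signed-shift ∘ splitAt 3

  shift-injective : Injective _≡_ _≡_ shift
  shift-injective {i} {j} eq = begin
    i                       ≡⟨ join-splitAt 3 3 i ⟨
    join 3 3 (splitAt 3 i)  ≡⟨ cong (join 3 3) (signed-shift-injective {splitAt 3 i} {splitAt 3 j} eq) ⟩
    join 3 3 (splitAt 3 j)  ≡⟨ join-splitAt 3 3 j ⟩
    j                       ∎
    where open ≡-Reasoning

  shift< : ∀ i → shift i < n
  shift< i with splitAt 3 i
  ... | inj₁ j = s≤s (≤-trans (toℕ<n j) (m≤m+n 3 (3 + q)))
  ... | inj₂ j = +-monoˡ-< (4 + q) (toℕ<n j)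

  adjacent⇒step : ∀ {v w} → Graph.Adj G v w → ∃ λ i → Step n (shift i) (toℕ v) (toℕ w)
  adjacent⇒step {v} {w} (inj₁ (here d)) = 0F , congruent⇒step (m≤m+n 1 _) v w d
  adjacent⇒step {v} {w} (inj₁ (there (here d))) = 1F , congruent⇒step (m≤m+n 2 _) v w d
  adjacent⇒step {v} {w} (inj₁ (there (there (here d)))) = 2F , congruent⇒step (m≤m+n 3 _) v w d
  adjacent⇒step {v} {w} (inj₂ (here d)) =
    5F , step-reverse {a = 1} refl (congruent⇒step (m≤m+n 1 _) w v d)
  adjacent⇒step {v} {w} (inj₂ (there (here d))) =
    4F , step-reverse {a = 2} refl (congruent⇒step (m≤m+n 2 _) w v d)
  adjacent⇒step {v} {w} (inj₂ (there (there (here d)))) =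
    3F , step-reverse {a = 3} refl (congruent⇒step (m≤m+n 3 _) w v d)

  step⇒adjacent : ∀ {v w} i → Step n (shift i) (toℕ v) (toℕ w) → Graph.Adj G v w
  step⇒adjacent {v} {w} 0F s = inj₁ (here (step⇒congruent v w s))
  step⇒adjacent {v} {w} 1F s = inj₁ (there (here (step⇒congruent v w s)))
  step⇒adjacent {v} {w} 2F s = inj₁ (there (there (here (step⇒congruent v w s))))
  step⇒adjacent {v} {w} 3F s =
    inj₂ (there (there (here (step⇒congruent w v (step-reverse (+-comm (4 + q) 3) s)))))
  step⇒adjacent {v} {w} 4F s =
    inj₂ (there (here (step⇒congruent w v (step-reverse (+-comm (5 + q) 2) s))))
  step⇒adjacent {v} {w} 5F s =
    inj₂ (here (step⇒congruent w v (step-reverse (+-comm (6 + q) 1) s)))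

  circulant-regular : Regular G 6
  circulant-regular = record
    { neighbour           = λ v i → proj₁ (go v i)
    ; neighbour-injective = λ v {i} {j} eq → shift-injective (step-injective {v = toℕ v} (shift< i) (shift< j)
        (proj₂ (go v i)) (subst (Step n (shift j) (toℕ v) ∘ toℕ) (sym eq) (proj₂ (go v j))))
    ; neighbour-adjacent  = λ v i → step⇒adjacent i (proj₂ (go v i))
    ; neighbour-complete  = λ {v} {w} adj → let i , s = adjacent⇒step adj in
        i , toℕ-injective (step-functional {a = shift i} {v = toℕ v} (toℕ<n w) (toℕ<n (proj₁ (go v i))) s (proj₂ (go v i)))
    }
    where
    go : ∀ v i → ∃ λ w → Step n (shift i) (toℕ v) (toℕ w)
    go v i = step (<⇒≤ (shift< i)) v

-- Positions of vertices in the cyclic order.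

position : ∀ {n} → Fin n → ℕ
position v = toℕ (positionOf v)

position-even : ∀ {n} (v : Fin n) k → toℕ v ≡ k * 2 → position v ≡ k
position-even {n} v k eq = trans (cong toℕ (positionOf-even v h (trans eq (cong (_* 2) (sym h≡k))))) h≡k
  where
  k<n : k < n
  k<n = ≤-<-trans (m≤m*n k 2) (subst (_< n) eq (toℕ<n v))
  h = fromℕ< k<n
  h≡k : toℕ h ≡ k
  h≡k = toℕ-fromℕ< k<n

-- Written as a sum so that no truncated subtraction enters the later computations with position
-- sums.
position-odd : ∀ {n} (v : Fin n) k → toℕ v ≡ suc (k * 2) → position v + suc k ≡ n
position-odd {n} v k eq = begin
  position v + suc k               ≡⟨ cong₂ _+_ (cong toℕ (positionOf-odd v h (trans eq (cong (suc ∘ (_* 2)) (sym h≡k)))))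
                                                (cong suc (sym h≡k)) ⟩
  toℕ (opposite h) + suc (toℕ h)   ≡⟨ opposite-sum h ⟩
  n                                ∎
  where
  open ≡-Reasoning
  k<n : k < n
  k<n = ≤-<-trans (≤-trans (m≤m*n k 2) (n≤1+n _)) (subst (_< n) eq (toℕ<n v))
  h = fromℕ< k<n
  h≡k : toℕ h ≡ k
  h≡k = toℕ-fromℕ< k<n

position-injective : ∀ {n} {v w : Fin n} → position v ≡ position w → v ≡ w
position-injective {v = v} {w} eq =
  trans (sym (vertexAt-positionOf v)) (trans (cong vertexAt (toℕ-injective eq)) (vertexAt-positionOf w))

even-or-odd : ∀ x → ∃ λ k → x ≡ k * 2 ⊎ x ≡ suc (k * 2)
even-or-odd zero = 0 , inj₁ refl
even-or-odd (suc x) with even-or-odd x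
... | k , inj₁ refl = k , inj₂ refl
... | k , inj₂ refl = suc k , inj₁ refl

-- Chords that cannot cross.

Consecutive : ℕ → ℕ → Set
Consecutive x y = y ≡ suc x ⊎ x ≡ suc y

-- Either way of crossing would put an endpoint of the other chord strictly between these two
-- positions.
consecutive-gapless : ∀ {x y z} → Consecutive x y → x ⊓ y < z → ¬ (z < x ⊔ y)
consecutive-gapless {x} {z = z} (inj₁ refl) x<z z<y =
  <⇒≱ (subst (_< z) (m≤n⇒m⊓n≡m (n≤1+n x)) x<z) (s≤s⁻¹ (subst (z <_) (m≤n⇒m⊔n≡n (n≤1+n x)) z<y))
consecutive-gapless {y = y} {z} (inj₂ refl) x<z z<y =
  <⇒≱ (subst (_< z) (m≥n⇒m⊓n≡n (n≤1+n y)) x<z) (s≤s⁻¹ (subst (z <_) (m≥n⇒m⊔n≡m (n≤1+n y)) z<y))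

-- Chords of a regular n-gon whose endpoints have the same sum modulo n are parallel.
OnAxis : ℕ → ℕ → ℕ → ℕ → Set
OnAxis n s x y = x + y ≡ s ⊎ x + y ≡ s + n

module _ {n s : ℕ} where

  on-axis-functional : ∀ {x y z} → y < n → z < n → OnAxis n s x y → OnAxis n s x z → y ≡ z
  on-axis-functional {x} {y} {z} y<n z<n p q with p | q
  ... | inj₁ p | inj₁ q = +-cancelˡ-≡ x y z (trans p (sym q))
  ... | inj₂ p | inj₂ q = +-cancelˡ-≡ x y z (trans p (sym q))
  ... | inj₁ p | inj₂ q = contradiction
    (≤-trans (m≤n+m n y) (≤-reflexive (+-cancelˡ-≡ x _ _
      (trans (sym (+-assoc x y n)) (trans (cong (_+ n) p) (sym q))))))
    (<⇒≱ z<n)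
  ... | inj₂ p | inj₁ q = contradiction
    (≤-trans (m≤n+m n z) (≤-reflexive (+-cancelˡ-≡ x _ _
      (trans (sym (+-assoc x z n)) (trans (cong (_+ n) q) (sym p))))))
    (<⇒≱ y<n)

  -- Alternation gives `x + y < x′ + y′ < y + n ≤ x + y + n`, so the two sums cannot be congruent
  -- modulo `n`.
  on-axis-alternating : ∀ {x y x′ y′} → y′ < n → OnAxis n s x y → OnAxis n s x′ y′ →
                        x < x′ → x′ < y → ¬ (y < y′)
  on-axis-alternating {x} {y} {x′} {y′} y′<n p q x<x′ x′<y y<y′ with p | q
  ... | inj₁ p | inj₁ q = <⇒≢ (+-mono-< x<x′ y<y′) (trans p (sym q))
  ... | inj₂ p | inj₂ q = <⇒≢ (+-mono-< x<x′ y<y′) (trans p (sym q))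
  ... | inj₂ p | inj₁ q = <⇒≱ (+-mono-< x<x′ y<y′)
    (≤-trans (m≤m+n _ n) (≤-reflexive (trans (cong (_+ n) q) (sym p))))
  ... | inj₁ p | inj₂ q = <⇒≢ (begin-strict
    x′ + y′    <⟨ +-mono-< x′<y y′<n ⟩
    y + n      ≤⟨ m≤n+m (y + n) x ⟩
    x + (y + n) ≡⟨ +-assoc x y n ⟨
    x + y + n  ∎) (trans q (cong (_+ n) (sym p)))
    where open ≤-Reasoning

⊓+⊔ : ∀ x y → x ⊓ y + (x ⊔ y) ≡ x + y
⊓+⊔ x y with ≤-total x y
... | inj₁ x≤y = cong₂ _+_ (m≤n⇒m⊓n≡m x≤y) (m≤n⇒m⊔n≡n x≤y)
... | inj₂ y≤x = trans (cong₂ _+_ (m≥n⇒m⊓n≡n y≤x) (m≥n⇒m⊔n≡m y≤x)) (+-comm y x)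

-- The seven pages.

-- Flips along each path of jumps by 2, whose edges thus alternate between pages 4 and 5. The phase
-- matters: wrapping edges occupy vertex 1 on page 4 and vertex 2 on page 5, and the bit is false at
-- 1 and true at 2.
second-bit : ℕ → Bool
second-bit 0             = false
second-bit 1             = false
second-bit (suc (suc x)) = not (second-bit x)

module Pages (q : ℕ) where

  n : ℕ
  n = 7 + q * 2

  -- With m = 3 + q, the common position sums modulo n = 2m + 1 of the parallel chords of each page:
  -- pages 0 and 1 hold the jumps by 1, pages 2 and 3 the jumps by 3 and the jumps by 2 next to the
  -- ends of the odd row, and each of pages 4 to 6 holds two of the six edges that wrap around n.
  axis : Fin 7 → ℕ
  axis 0F = 6 + q * 2
  axis 1F = n
  axis 2F = 5 + q * 2
  axis 3F = 1
  axis 4F = 3 + q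
  axis 5F = 4 + q
  axis 6F = 2 + q

  -- The lower endpoints of the remaining jumps by 2.
  Short : Fin 7 → ℕ → Set
  Short 4F v = 1 ≤ v × 5 + v ≤ n × second-bit v ≡ true
  Short 5F v = 1 ≤ v × 5 + v ≤ n × second-bit v ≡ false
  Short 6F v = 4 + v ≡ n
  Short _  v = ⊥

  -- A set containing the endpoints of the parallel chords; on pages 4 to 6 no short chord meets it.
  Rim : Fin 7 → ℕ → Set
  Rim 4F v = v < 2 ⊎ 2 + v ≥ n
  Rim 5F v = (v ≡ 0 ⊎ v ≡ 2) ⊎ 2 + v ≥ n
  Rim 6F v = v < 2 ⊎ 3 + v ≡ n ⊎ 1 + v ≡ n
  Rim _  v = ⊤

  short-not-rim : ∀ c v → Short c v → ¬ Rim c v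
  short-not-rim 4F 0 (() , _)
  short-not-rim 4F 1 (_ , _ , ())
  short-not-rim 4F (suc (suc v)) (_ , _ , _) (inj₁ (s≤s (s≤s ())))
  short-not-rim 4F v (_ , b , _) (inj₂ r) = <⇒≱ (<-≤-trans (+-monoˡ-< v {2} {5} (m≤m+n 3 2)) b) r
  short-not-rim 5F v (() , _) (inj₁ (inj₁ refl))
  -- `second-bit 2` is true, which keeps the jump starting at 2 off page 5.
  short-not-rim 5F v (_ , _ , ()) (inj₁ (inj₂ refl))
  short-not-rim 5F v (_ , b , _) (inj₂ r) = <⇒≱ (<-≤-trans (+-monoˡ-< v {2} {5} (m≤m+n 3 2)) b) r
  short-not-rim 6F 0 () (inj₁ _)
  short-not-rim 6F 1 () (inj₁ _)
  short-not-rim 6F (suc (suc v)) _ (inj₁ (s≤s (s≤s ())))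
  short-not-rim 6F v e (inj₂ (inj₁ r)) = contradiction (trans r (sym e)) λ ()
  short-not-rim 6F v e (inj₂ (inj₂ r)) = contradiction (trans r (sym e)) λ ()

  short-end-not-rim : ∀ c v → Short c v → ¬ Rim c (2 + v)
  short-end-not-rim 4F v (_ , b , _) (inj₁ (s≤s (s≤s ())))
  short-end-not-rim 4F v (_ , b , _) (inj₂ r) = <⇒≱ b r
  short-end-not-rim 5F v (() , _) (inj₁ (inj₂ refl))
  short-end-not-rim 5F v (_ , b , _) (inj₂ r) = <⇒≱ b r
  short-end-not-rim 6F v e (inj₁ (s≤s (s≤s ())))
  short-end-not-rim 6F v e (inj₂ (inj₁ r)) = contradiction (trans r (sym e)) λ ()
  short-end-not-rim 6F v e (inj₂ (inj₂ r)) = contradiction (trans r (sym e)) λ ()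

  short-not-repeated : ∀ c v → Short c v → ¬ Short c (2 + v)
  short-not-repeated 4F v (_ , _ , b) (_ , _ , b′) = contradiction (trans (sym (cong not b)) b′) λ ()
  short-not-repeated 5F v (_ , _ , b) (_ , _ , b′) = contradiction (trans (sym (cong not b)) b′) λ ()
  short-not-repeated 6F v e e′ = contradiction (trans e (sym e′)) λ ()

  -- The axis equation alone describes a whole family of parallel chords; on pages 4 to 6 `Rim` cuts
  -- it down to make room for the short ones.
  data Page (c : Fin 7) (v w : Fin n) : Set where
    parallel : Rim c (toℕ v) → Rim c (toℕ w) → OnAxis n (axis c) (position v) (position w) → Page c v w
    short    : Short c (toℕ v) → toℕ w ≡ 2 + toℕ v → Page c v w
    short˘   : Short c (toℕ w) → toℕ v ≡ 2 + toℕ w → Page c v w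

  page-sym : ∀ {c v w} → Page c v w → Page c w v
  page-sym {c} {v} {w} (parallel r r′ a) =
    parallel r′ r (subst (λ s → s ≡ axis c ⊎ s ≡ axis c + n) (+-comm (position v) (position w)) a)
  page-sym (short s eq)  = short˘ s eq
  page-sym (short˘ s eq) = short s eq

  -- Each page is a matching: the axis determines the partner on a parallel chord, `Rim` separates
  -- parallel from short chords, and two short chords in a row are excluded.
  page-functional : ∀ {c v w x} → Page c v w → Page c v x → w ≡ x
  page-functional {c} {v} {w} {x} p q with p | q
  ... | parallel _ _ a | parallel _ _ a′ =
    position-injective (on-axis-functional {x = position v} (toℕ<n (positionOf w)) (toℕ<n (positionOf x)) a a′)
  ... | parallel r _ _ | short s _   = contradiction r (short-not-rim c _ s)
  ... | parallel r _ _ | short˘ s eq = contradiction (subst (Rim c) eq r) (short-end-not-rim c _ s)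
  ... | short s _   | parallel r _ _ = contradiction r (short-not-rim c _ s)
  ... | short˘ s eq | parallel r _ _ = contradiction (subst (Rim c) eq r) (short-end-not-rim c _ s)
  ... | short _ eq  | short _ eq′    = toℕ-injective (trans eq (sym eq′))
  ... | short˘ _ eq | short˘ _ eq′   = toℕ-injective (suc-injective (suc-injective (trans (sym eq) eq′)))
  ... | short s _   | short˘ s′ eq   = contradiction (subst (Short c) eq s) (short-not-repeated c _ s′)
  ... | short˘ s eq | short s′ _     = contradiction (subst (Short c) eq s′) (short-not-repeated c _ s)

  -- A jump by 2 keeps the parity, and the order runs upwards through the even elements of `Fin n`
  -- and downwards through the odd ones.
  two-apart : (v w : Fin n) → toℕ w ≡ 2 + toℕ v → Consecutive (position v) (position w)
  two-apart v w eq with even-or-odd (toℕ v)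
  ... | k , inj₁ v≡ = inj₁ (trans (position-even w (suc k) (trans eq (cong (2 +_) v≡)))
                                  (cong suc (sym (position-even v k v≡))))
  ... | k , inj₂ v≡ = inj₂ (+-cancelʳ-≡ (suc k) _ _ (begin
    position v + suc k        ≡⟨ position-odd v k v≡ ⟩
    n                         ≡⟨ position-odd w (suc k) (trans eq (cong (2 +_) v≡)) ⟨
    position w + suc (suc k)  ≡⟨ +-suc (position w) (suc k) ⟩
    suc (position w) + suc k  ∎))
    where open ≡-Reasoning

  parallel-or-consecutive : ∀ {c v w} → Page c v w →
    OnAxis n (axis c) (position v) (position w) ⊎ Consecutive (position v) (position w)
  parallel-or-consecutive (parallel _ _ a) = inj₁ a
  parallel-or-consecutive {v = v} {w} (short _ eq)  = inj₂ (two-apart v w eq)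
  parallel-or-consecutive {v = v} {w} (short˘ _ eq) = inj₂ (Sum.swap (two-apart w v eq))

  right<n : ∀ {G : Graph n} (e : Edge G) → right (ω n) e < n
  right<n e = ⊔-lub (toℕ<n (positionOf (lo e))) (toℕ<n (positionOf (hi e)))

  on-axis-ordered : ∀ {G : Graph n} {s} (e : Edge G) → OnAxis n s (position (lo e)) (position (hi e)) →
                    OnAxis n s (left (ω n) e) (right (ω n) e)
  on-axis-ordered {s = s} e =
    subst (λ t → t ≡ s ⊎ t ≡ s + n) (sym (⊓+⊔ (position (lo e)) (position (hi e))))

  page-noncrossing : ∀ {G : Graph n} {c} (e f : Edge G) → Page c (lo e) (hi e) → Page c (lo f) (hi f) →
                     ¬ Cross (ω n) e f
  page-noncrossing e f p q with parallel-or-consecutive p | parallel-or-consecutive q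
  ... | inj₂ adj | _ = λ where
    (inj₁ (a , b , _)) → consecutive-gapless adj a b
    (inj₂ (_ , a , b)) → consecutive-gapless adj a b
  ... | inj₁ _   | inj₂ adj = λ where
    (inj₁ (_ , a , b)) → consecutive-gapless adj a b
    (inj₂ (a , b , _)) → consecutive-gapless adj a b
  ... | inj₁ α | inj₁ β = λ where
    (inj₁ (a , b , d)) → on-axis-alternating (right<n f) (on-axis-ordered e α) (on-axis-ordered f β) a b d
    (inj₂ (a , b , d)) → on-axis-alternating (right<n e) (on-axis-ordered f β) (on-axis-ordered e α) a b d

  -- Every edge lies on a page.

  Colored : Fin n → Fin n → Set
  Colored v w = ∃ λ c → Page c v w

  module _ (v : Fin n) where

    position-of-0 : toℕ v ≡ 0 → position v ≡ 0
    position-of-0 = position-even v 0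

    position-of-1 : toℕ v ≡ 1 → position v ≡ 6 + q * 2
    position-of-1 eq = +-cancelʳ-≡ 1 _ _ (trans (position-odd v 0 eq) (+-comm 1 (6 + q * 2)))

    position-of-2 : toℕ v ≡ 2 → position v ≡ 1
    position-of-2 = position-even v 1

    position-of-n-1 : 1 + toℕ v ≡ n → position v ≡ 3 + q
    position-of-n-1 eq = position-even v (3 + q) (suc-injective eq)

    position-of-n-2 : 2 + toℕ v ≡ n → position v ≡ 4 + q
    position-of-n-2 eq = +-cancelʳ-≡ (3 + q) _ _
      (trans (position-odd v (2 + q) (+-cancelˡ-≡ 2 _ _ eq)) (n≡ q))
      where
      n≡ : ∀ q → 7 + q * 2 ≡ 4 + q + (3 + q)
      n≡ = solve-∀

    position-of-n-3 : 3 + toℕ v ≡ n → position v ≡ 2 + q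
    position-of-n-3 eq = position-even v (2 + q) (+-cancelˡ-≡ 3 _ _ eq)

  module _ (v w : Fin n) where

    private
      V = toℕ v
      W = toℕ w

      on-axis : ∀ {s x y} → position v ≡ x → position w ≡ y → x + y ≡ s ⊎ x + y ≡ s + n →
                OnAxis n s (position v) (position w)
      on-axis refl refl = id

    -- The ends differ in parity, so one position grows with `k` and the other shrinks. Their sum
    -- depends only on the parity of `V`, which selects the page; the jumps by 3 behave alike.
    color-jump-1 : W ≡ 1 + V → Colored v w
    color-jump-1 eq with even-or-odd V
    ... | k , inj₁ v≡ = 0F , parallel tt tt (inj₁ (suc-injective (begin
      suc (position v + position w)  ≡⟨ cong (λ x → suc (x + position w)) (position-even v k v≡) ⟩
      suc k + position w             ≡⟨ +-comm (suc k) (position w) ⟩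
      position w + suc k             ≡⟨ position-odd w k (trans eq (cong suc v≡)) ⟩
      n                              ∎)))
      where open ≡-Reasoning
    ... | k , inj₂ v≡ = 1F , parallel tt tt (inj₁ (begin
      position v + position w  ≡⟨ cong (position v +_) (position-even w (suc k) (trans eq (cong suc v≡))) ⟩
      position v + suc k       ≡⟨ position-odd v k v≡ ⟩
      n                        ∎))
      where open ≡-Reasoning

    color-jump-3 : W ≡ 3 + V → Colored v w
    color-jump-3 eq with even-or-odd V
    ... | k , inj₁ v≡ = 2F , parallel tt tt (inj₁ (suc-injective (suc-injective (begin
      2 + (position v + position w)  ≡⟨ cong (λ x → 2 + (x + position w)) (position-even v k v≡) ⟩
      2 + k + position w             ≡⟨ +-comm (2 + k) (position w) ⟩
      position w + (2 + k)           ≡⟨ position-odd w (suc k) (trans eq (cong (3 +_) v≡)) ⟩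
      n                              ∎))))
      where open ≡-Reasoning
    -- The sum is `n + 1`, which is 1 modulo `n`.
    ... | k , inj₂ v≡ = 3F , parallel tt tt (inj₂ (begin
      position v + position w    ≡⟨ cong (position v +_) (position-even w (2 + k) (trans eq (cong (3 +_) v≡))) ⟩
      position v + (2 + k)       ≡⟨ +-suc (position v) (suc k) ⟩
      suc (position v + suc k)   ≡⟨ cong suc (position-odd v k v≡) ⟩
      1 + n                      ∎))
      where open ≡-Reasoning

    color-jump-2 : W ≡ 2 + V → Colored v w
    color-jump-2 eq with V ≟ 0 | 3 + V ≟ n | 4 + V ≟ n | second-bit V in b
    -- Wrapping edges occupy vertex 0 on all of pages 4 to 6, but 0 and 2 are adjacent positions
    -- with sum 1, the axis of page 3.
    ... | yes v≡ | _ | _ | _ =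
      3F , parallel tt tt (on-axis (position-of-0 v v≡) (position-of-2 w (trans eq (cong (2 +_) v≡))) (inj₁ refl))
    -- Likewise `n - 1` is occupied on pages 4 to 6, and this chord fits the axis of page 2.
    ... | no _ | yes v≡ | _ | _ =
      2F , parallel tt tt (on-axis (position-of-n-3 v v≡) (position-of-n-1 w (trans (cong suc eq) v≡)) (inj₁ (sum≡ q)))
      where
      sum≡ : ∀ q → 2 + q + (3 + q) ≡ 5 + q * 2
      sum≡ = solve-∀
    -- The upper end `n - 2` is taken on pages 4 and 5 but free on page 6.
    ... | no _ | no _ | yes v≡ | _ = 6F , short v≡ eq
    -- `W < n` reads `3 + V ≤ n`; each excluded equality raises the bound by one, up to `5 + V ≤ n`.
    ... | no v≢0 | no v≢n-3 | no v≢n-4 | true =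
      4F , short (n≢0⇒n>0 v≢0 , ≤∧≢⇒< (≤∧≢⇒< (subst (_< n) eq (toℕ<n w)) v≢n-3) v≢n-4 , b) eq
    ... | no v≢0 | no v≢n-3 | no v≢n-4 | false =
      5F , short (n≢0⇒n>0 v≢0 , ≤∧≢⇒< (≤∧≢⇒< (subst (_< n) eq (toℕ<n w)) v≢n-3) v≢n-4 , b) eq

    -- Here `v` is the end reached after wrapping. Since `W < n`, a jump by `a` wraps onto at most
    -- `a` vertices, leaving 1 + 2 + 3 edges to treat.
    wraps-early : ∀ {a} → V + n ≡ W + a → V < a
    wraps-early {a} eq = +-cancelʳ-< n V a (begin-strict
      V + n  ≡⟨ eq ⟩
      W + a  <⟨ +-monoˡ-< a (toℕ<n w) ⟩
      n + a  ≡⟨ +-comm n a ⟩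
      a + n  ∎)
      where open ≤-Reasoning

    wraps-to : ∀ {x} b → V ≡ x → V + n ≡ W + (x + b) → b + W ≡ n
    wraps-to {x} b refl eq = sym (+-cancelˡ-≡ V _ _ (trans eq (rearrange W V b)))
      where
      rearrange : ∀ w v b → w + (v + b) ≡ v + (b + w)
      rearrange = solve-∀

    color-wrap-1 : V + n ≡ W + 1 → Colored v w
    color-wrap-1 eq = 4F , parallel (inj₁ (≤-trans (≤-reflexive (cong suc v≡0)) (n≤1+n 1)))
                                    (inj₂ (≤-trans (≤-reflexive (sym w≡)) (n≤1+n _)))
      (on-axis (position-of-0 v v≡0) (position-of-n-1 w w≡) (inj₁ refl))
      where
      v≡0 = n<1⇒n≡0 (wraps-early eq)
      w≡  = wraps-to 1 v≡0 eq

    color-wrap-2 : V + n ≡ W + 2 → Colored v w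
    color-wrap-2 eq with V in v≡ | wraps-early eq
    ... | 0 | _ = 5F , parallel (inj₁ (inj₁ v≡)) (inj₂ (≤-reflexive (sym w≡)))
      (on-axis (position-of-0 v v≡) (position-of-n-2 w w≡) (inj₁ refl))
      where w≡ = wraps-to 2 v≡ eq
    -- Vertex 1 is in the last position, so the sum exceeds the axis by `n`.
    ... | 1 | _ = 6F , parallel (inj₁ (s≤s (≤-reflexive v≡))) (inj₂ (inj₂ w≡))
      (on-axis (position-of-1 v v≡) (position-of-n-1 w w≡) (inj₂ (sum≡ q)))
      where
      w≡ = wraps-to 1 v≡ eq
      sum≡ : ∀ q → 6 + q * 2 + (3 + q) ≡ 2 + q + (7 + q * 2)
      sum≡ = solve-∀
    ... | suc (suc _) | s≤s (s≤s ())

    color-wrap-3 : V + n ≡ W + 3 → Colored v w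
    color-wrap-3 eq with V in v≡ | wraps-early eq
    ... | 0 | _ = 6F , parallel (inj₁ (≤-trans (≤-reflexive (cong suc v≡)) (n≤1+n 1))) (inj₂ (inj₁ w≡))
      (on-axis (position-of-0 v v≡) (position-of-n-3 w w≡) (inj₁ refl))
      where w≡ = wraps-to 3 v≡ eq
    ... | 1 | _ = 4F , parallel (inj₁ (s≤s (≤-reflexive v≡))) (inj₂ (≤-reflexive (sym w≡)))
      (on-axis (position-of-1 v v≡) (position-of-n-2 w w≡) (inj₂ (sum≡ q)))
      where
      w≡ = wraps-to 2 v≡ eq
      sum≡ : ∀ q → 6 + q * 2 + (4 + q) ≡ 3 + q + (7 + q * 2)
      sum≡ = solve-∀
    ... | 2 | _ = 5F , parallel (inj₁ (inj₂ v≡)) (inj₂ (≤-trans (≤-reflexive (sym w≡)) (n≤1+n _)))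
      (on-axis (position-of-2 v v≡) (position-of-n-1 w w≡) (inj₁ refl))
      where w≡ = wraps-to 1 v≡ eq
    ... | suc (suc (suc _)) | s≤s (s≤s (s≤s ()))

  colored-sym : ∀ {v w} → Colored v w → Colored w v
  colored-sym (c , p) = c , page-sym p

  step-colored : ∀ {v w} i → Step n (1 + toℕ {3} i) (toℕ v) (toℕ w) → Colored v w
  step-colored {v} {w} 0F (inj₁ eq) = color-jump-1 v w (trans eq (+-comm (toℕ v) 1))
  step-colored {v} {w} 1F (inj₁ eq) = color-jump-2 v w (trans eq (+-comm (toℕ v) 2))
  step-colored {v} {w} 2F (inj₁ eq) = color-jump-3 v w (trans eq (+-comm (toℕ v) 3))
  step-colored {v} {w} 0F (inj₂ eq) = colored-sym (color-wrap-1 w v eq)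
  step-colored {v} {w} 1F (inj₂ eq) = colored-sym (color-wrap-2 w v eq)
  step-colored {v} {w} 2F (inj₂ eq) = colored-sym (color-wrap-3 w v eq)

  jump-colored : ∀ {v w} → Jump (1 ∷ 2 ∷ 3 ∷ []) v w → Colored v w
  jump-colored {v} {w} (here d)                 = step-colored 0F (congruent⇒step (m≤m+n 1 _) v w d)
  jump-colored {v} {w} (there (here d))         = step-colored 1F (congruent⇒step (m≤m+n 2 _) v w d)
  jump-colored {v} {w} (there (there (here d))) = step-colored 2F (congruent⇒step (m≤m+n 3 _) v w d)

  -- The edge coloring.

  module _ (7≤n : 7 ≤ n) where

    G : Graph n
    G = C n (1 ∷ 2 ∷ 3 ∷ []) (jumps-1-2-3 7≤n)

    edge-colored : (e : Edge G) → Colored (lo e) (hi e)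
    -- The adjacency proof is irrelevant, so a usable one is computed by deciding adjacency.
    edge-colored (edge v w _ adj) with recompute (Graph.adj? G v w) adj
    ... | inj₁ j = jump-colored j
    ... | inj₂ j = colored-sym (jump-colored j)

    color : Edge G → Fin 7
    color = proj₁ ∘ edge-colored

    color-noncrossing : ∀ e f → e ≢ f → color e ≡ color f → ¬ Cross (ω n) e f
    color-noncrossing e f _ same =
      page-noncrossing e f (proj₂ (edge-colored e)) (subst (λ c → Page c _ _) (sym same) (proj₂ (edge-colored f)))

    color-matching : IsMatching color
    color-matching e f e≢f same = go
      where
      p = proj₂ (edge-colored e)
      p′ : Page (color e) (lo f) (hi f)
      p′ = subst (λ c → Page c _ _) (sym same) (proj₂ (edge-colored f))
      from : ∀ {v v′ w w′} → v ≡ v′ → Page (color e) v w → Page (color e) v′ w′ → w ≡ w′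
      from refl = page-functional
      -- Edges list the smaller end first, so two of them never agree with their ends exchanged.
      reversed : lo e ≡ hi f → hi e ≡ lo f → e ≡ f
      reversed lo≡hi hi≡lo = contradiction
        (<-trans (lo<hi e)
          (subst₂ Fin._<_ (sym hi≡lo) (sym lo≡hi) (lo<hi f)))
        (<-irrefl refl)
      go : ¬ ShareEndpoint e f
      go (inj₁ (inj₁ eq)) = e≢f (edge-≡ eq (from eq p p′))
      go (inj₁ (inj₂ eq)) = e≢f (reversed eq (from eq p (page-sym p′)))
      go (inj₂ (inj₁ eq)) = e≢f (reversed (from eq (page-sym p) p′) eq)
      go (inj₂ (inj₂ eq)) = e≢f (edge-≡ (from eq (page-sym p) (page-sym p′)) eq)

-- Conclusion for odd n.

odd-form : ∀ n → 7 ≤ n → n % 2 ≡ 1 → ∃ λ q → n ≡ 7 + q * 2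
odd-form n 7≤n odd with n / 2 | m≡m%n+[m/n]*n n 2
... | suc (suc (suc q)) | eq = q , trans eq (cong (_+ (3 + q) * 2) odd)
... | 0 | eq = contradiction (subst (7 ≤_) (trans eq (cong (_+ 0) odd)) 7≤n) λ { (s≤s ()) }
... | 1 | eq = contradiction (subst (7 ≤_) (trans eq (cong (_+ 2) odd)) 7≤n) λ { (s≤s (s≤s (s≤s ()))) }
... | 2 | eq = contradiction (subst (7 ≤_) (trans eq (cong (_+ 4) odd)) 7≤n) λ { (s≤s (s≤s (s≤s (s≤s (s≤s ()))))) }

odd≢h+h : ∀ q h → 7 + q * 2 ≢ h + h
odd≢h+h q h eq = contradiction
  (trans (sym ([m+kn]%n≡m%n 7 q 2)) (trans (cong (_% 2) (trans eq (sym (double h)))) (m*n%n≡0 h 2))) λ ()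

-- With the equation as an argument, matching on `refl` replaces `n` in the graph and in the type of
-- `7≤n` at once.
odd-circulant : ∀ {n} (7≤n : 7 ≤ n) → (∃ λ q → n ≡ 7 + q * 2) →
                NearlyDispersableWrt (C n (1 ∷ 2 ∷ 3 ∷ []) (jumps-1-2-3 7≤n)) (ω n)
odd-circulant 7≤n (q , refl) =
  regular-odd-nearly-dispersable {G = C _ (1 ∷ 2 ∷ 3 ∷ []) (jumps-1-2-3 7≤n)}
    (circulant-regular (q * 2) 7≤n) 0F (odd≢h+h q)
    (Pages.color q 7≤n) (Pages.color-matching q 7≤n) (Pages.color-noncrossing q 7≤n)

theorem6 : (n : ℕ) (7≤n : 7 ≤ n) → n % 2 ≡ 1 →
    NearlyDispersableWrt (C n (1 ∷ 2 ∷ 3 ∷ []) (jumps-1-2-3 7≤n)) (ω n)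
theorem6 n 7≤n odd = odd-circulant 7≤n (odd-form n 7≤n odd)
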